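{- There exists a first countable, locally compact, scattered topological space of cardinality $\omega_1$ which has property $P_{<\omega}$.
   Context: For a natural number $n\ge 1$, a topological space $X$ has property $P_n$ if it is Hausdorff and, whenever $U_0,\dots,U_{n-1}$ are open subsets of $X$ with $\bigcap_{i<n}U_i=\emptyset$, we have $|U_i|\le\omega$ for some $i<n$. A space has property $P_{<\omega}$ if it has property $P_n$ for every $n<\omega$. A space is scattered if every nonempty subspace has an isolated point. -}

module Defs where

open import Data.Fin.Base using (Fin)
open import Data.List.Base using (List)
open import Data.List.Relation.Unary.Any using (Any)
open import Data.Nat.Base using (ℕ; _≤_)
open import Data.Product.Base using (Σ-syntax; ∃-syntax; _×_)
open import Function.Bundles using (_⤖_)
open import Induction.WellFounded using (WellFounded)
open import Level using (0ℓ)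
open import Relation.Binary.Core using (Rel)
open import Relation.Binary.PropositionalEquality.Core using (_≡_; _≢_)
open import Relation.Binary.Structures using (IsStrictTotalOrder)
open import Relation.Nullary.Negation.Core using (¬_)
open import Relation.Unary
  using (Pred; _∈_; _⊆_; _≐_; _∩_; ⋃; ⋂; ∅; U; ｛_｝; Empty; Satisfiable)

Subset : Set → Set₁
Subset X = Pred X 0ℓ

-- |A| ≤ ω: some function is injective on A. A total function on X loses
-- nothing classically, since ℕ is inhabited.
Countable : {X : Set} → Subset X → Set
Countable {X} A =
  Σ[ f ∈ (X → ℕ) ] (∀ {x y} → x ∈ A → y ∈ A → f x ≡ f y → x ≡ y)

-- (W , _≺_) is a copy of the ordinal ω₁, the least uncountable ordinal: an
-- uncountable well-order all of whose proper initial segments are countable.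
record Isω₁ {W : Set} (_≺_ : Rel W 0ℓ) : Set where
  field
    isStrictTotalOrder : IsStrictTotalOrder _≡_ _≺_
    wellFounded        : WellFounded _≺_
    segmentsCountable  : ∀ w → Countable (λ v → v ≺ w)
    uncountable        : ¬ Countable {W} U

HasCardinalityω₁ : Set → Set₁
HasCardinalityω₁ X = Σ[ W ∈ Set ] Σ[ _≺_ ∈ Rel W 0ℓ ] (Isω₁ _≺_ × (X ⤖ W))

-- Subsets are predicates, so openness must be invariant under having the same
-- elements. Unions of small indexed families are arbitrary unions: with
-- excluded middle and function extensionality, every family of subsets of X
-- can be indexed by a subset of X → Bool.
record Topology (X : Set) : Set₁ where
  field
    IsOpen    : Subset X → Set
    open-resp : ∀ {A B} → A ≐ B → IsOpen A → IsOpen B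
    open-∅    : IsOpen ∅
    open-U    : IsOpen U
    open-∩    : ∀ {A B} → IsOpen A → IsOpen B → IsOpen (A ∩ B)
    open-⋃    : (I : Set) (A : I → Subset X) →
                (∀ i → IsOpen (A i)) → IsOpen (⋃ I A)

module _ {X : Set} (𝒯 : Topology X) where
  open Topology 𝒯

  Hausdorff : Set₁
  Hausdorff = ∀ x y → x ≢ y →
    Σ[ A ∈ Subset X ] Σ[ B ∈ Subset X ]
      (IsOpen A × IsOpen B × x ∈ A × y ∈ B × Empty (A ∩ B))

  FirstCountable : Set₁
  FirstCountable = ∀ x →
    Σ[ B ∈ (ℕ → Subset X) ]
      ((∀ n → IsOpen (B n) × x ∈ B n) ×
       (∀ A → IsOpen A → x ∈ A → ∃[ n ] B n ⊆ A))

  -- The list names the members of a finite subcover.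
  Compact : Subset X → Set₁
  Compact K = (I : Set) (A : I → Subset X) → (∀ i → IsOpen (A i)) →
    K ⊆ ⋃ I A → Σ[ is ∈ List I ] (∀ {x} → x ∈ K → Any (λ i → x ∈ A i) is)

  LocallyCompact : Set₁
  LocallyCompact = ∀ x →
    Σ[ K ∈ Subset X ] Σ[ A ∈ Subset X ]
      (Compact K × IsOpen A × x ∈ A × A ⊆ K)

  -- x is isolated in the subspace A: {x} is the trace on A of an open set.
  IsolatedIn : Subset X → X → Set₁
  IsolatedIn A x = Σ[ B ∈ Subset X ] (IsOpen B × (A ∩ B) ≐ ｛ x ｝)

  Scattered : Set₁
  Scattered = (A : Subset X) → Satisfiable A → ∃[ x ] (x ∈ A × IsolatedIn A x)

  PropertyP : ℕ → Set₁
  PropertyP n = Hausdorff ×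
    ((A : Fin n → Subset X) → (∀ i → IsOpen (A i)) →
     Empty (⋂ (Fin n) A) → ∃[ i ] Countable (A i))

  PropertyP<ω : Set₁
  PropertyP<ω = ∀ n → 1 ≤ n → PropertyP n

{-# OPTIONS --safe #-}

-- Fix a well-order of type ω₁ on X and c : X → ℕ with all fibres unbounded. By
-- recursion along the order, α gets the neighbourhoods
--   N α k = {α} ∪ ⋃_{j ≥ k} (finite union of sets N γ l with γ ≺ α),
-- so initial segments are open, least elements are isolated, and N α k is
-- compact. The j-th union avoids {c < j} and the neighbourhoods N β 0 of the
-- first j elements β ≺ α, which gives the Hausdorff property and makes every
-- {c ≤ j} closed discrete. Subject to this, it contains a point of N β j above
-- η, whenever one is available, for each of the finitely many β and η in {c ≤ j}
-- covered by the first j + 1 neighbourhoods, and a point above η, if available, for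
-- each such η. The latter puts points above η into every neighbourhood of β as
-- soon as every fibre of c has infinitely many elements between η and β.
--
-- Let A and B be open and uncountable. There are k, l, n such that N α k ⊆ A for
-- uncountably many α ∈ A, and N β l ⊆ B for uncountably many β ∈ B with c β = n.
-- Given η, take such an α with infinitely many such β between η and α. As
-- {c ≤ n} is closed discrete, some β is first covered at a late stage j, and
-- there N α k received a point of N β l above η. So A ∩ B is again uncountable,
-- and P_n follows for all n simultaneously.
module Submission where

open import Defs
open import Axiom.ExcludedMiddle using (ExcludedMiddle)
open import Axiom.Extensionality.Propositional using (Extensionality; implicit-extensionality)
open import Axiom.UniquenessOfIdentityProofs.WithK using (uip)
open import Data.Bool.Base using (Bool; true)
open import Data.Empty using (⊥)
open import Data.Fin.Base using (Fin; zero; suc)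
open import Data.List.Base using (List; []; _∷_; _++_; map; cartesianProduct)
open import Data.List.Membership.Propositional using (lose; find) renaming (_∈_ to _∈ₗ_)
open import Data.List.Membership.Propositional.Properties
  using (finite; ∈-map⁺; ∈-cartesianProduct⁺)
open import Data.List.Relation.Unary.All as All using (All; []; _∷_)
open import Data.List.Relation.Unary.Any as Any using (Any; here; there)
open import Data.List.Relation.Unary.Any.Properties using (++⁺ˡ; ++⁺ʳ)
open import Data.Maybe.Base using (Maybe; just; nothing)
import Data.Maybe.Relation.Unary.All as Maybe
open import Data.Nat.Base as ℕ using (ℕ; zero; suc)
import Data.Nat.Properties as ℕ
open import Data.Product.Base using (Σ-syntax; ∃-syntax; _×_; _,_; proj₁; proj₂)
open import Data.Sum.Base using (_⊎_; inj₁; inj₂)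
open import Data.Unit.Base using (⊤; tt)
open import Function.Base using (_∘_; case_of_; id)
open import Function.Bundles using (mk⇔; mk↣)
open import Function.Construct.Identity using (⤖-id)
open import Induction.WellFounded using (WellFounded; Acc; acc; module All)
open import Level using (0ℓ)
open import Relation.Binary.Core using (Rel)
open import Relation.Binary.Definitions using (Trichotomous; tri<; tri≈; tri>)
open import Relation.Binary.PropositionalEquality
  using (_≡_; _≢_; refl; sym; trans; cong; subst; isEquivalence)
open import Relation.Binary.Structures using (IsStrictTotalOrder)
open import Relation.Nullary using (yes; no; does; ¬_; contradiction)
open import Relation.Nullary.Decidable using (does-⇔; dec-true; decidable-stable)
open import Relation.Unary using (_∈_; _⊆_; _≐_; _∩_; ⋂; Empty)

-- `pair m n + 1` is 2^m (2n + 1).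
pair : ℕ → ℕ → ℕ
pair zero    n = 2 ℕ.* n
pair (suc m) n = suc (2 ℕ.* pair m n)

pair-injective : ∀ m n {m′ n′} → pair m n ≡ pair m′ n′ → m ≡ m′ × n ≡ n′
pair-injective zero    n {zero}   eq = refl , ℕ.*-cancelˡ-≡ _ _ 2 eq
pair-injective zero    n {suc m′} {n′} eq = contradiction eq (ℕ.even≢odd n (pair m′ n′))
pair-injective (suc m) n {zero}   {n′} eq = contradiction (sym eq) (ℕ.even≢odd n′ (pair m n))
pair-injective (suc m) n {suc m′} eq
  with refl , n≡n′ ← pair-injective m n {m′} (ℕ.*-cancelˡ-≡ _ _ 2 (ℕ.suc-injective eq))
  = refl , n≡n′

-- Only strict upper bounds are asked for: this is the uncountable cofinality of ω₁.
HasSuprema : {X : Set} → Rel X 0ℓ → Set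
HasSuprema {X} _≺_ = (s : ℕ → X) → ∃[ h ] (∀ n → s n ≺ h)

-- The ordinal ω₁ as Brouwer trees modulo equality of rank.

module Trees where

  data Tree : Set where
    leaf : Tree
    node : (ℕ → Tree) → Tree

  infix 4 _≤_ _<_ _∼_

  -- Comparison of ranks, where node f has rank sup (rank (f n) + 1).
  _≤_ _<_ _∼_ : Rel Tree 0ℓ

  leaf   ≤ y = ⊤
  node f ≤ y = ∀ n → f n < y

  x < leaf   = ⊥
  x < node g = ∃[ n ] x ≤ g n

  x ∼ y = x ≤ y × y ≤ x

  ≤-refl : ∀ x → x ≤ x
  ≤-refl leaf     = tt
  ≤-refl (node f) = λ n → n , ≤-refl (f n)

  ≤-trans   : ∀ x y z → x ≤ y → y ≤ z → x ≤ z
  <-≤-trans : ∀ x y z → x < y → y ≤ z → x < z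
  ≤-<-trans : ∀ x y z → x ≤ y → y < z → x < z

  ≤-trans leaf     y z x≤y y≤z = tt
  ≤-trans (node f) y z x≤y y≤z = λ n → <-≤-trans (f n) y z (x≤y n) y≤z

  <-≤-trans x (node g) z (n , x≤gn) y≤z = ≤-<-trans x (g n) z x≤gn (y≤z n)

  ≤-<-trans x y (node h) x≤y (n , y≤hn) = n , ≤-trans x y (h n) x≤y y≤hn

  <⇒≤ : ∀ x y → x < y → x ≤ y
  <⇒≤ leaf     y        x<y        = tt
  <⇒≤ (node f) (node g) (n , x≤gn) = λ m → n , <⇒≤ (f m) (g n) (x≤gn m)

  <-trans : ∀ x y z → x < y → y < z → x < z
  <-trans x y z x<y y<z = <-≤-trans x y z x<y (<⇒≤ y z y<z)

  ∼-sym : ∀ {x y} → x ∼ y → y ∼ x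
  ∼-sym (x≤y , y≤x) = y≤x , x≤y

  ∼-trans : ∀ {x y z} → x ∼ y → y ∼ z → x ∼ z
  ∼-trans (x≤y , y≤x) (y≤z , z≤y) = ≤-trans _ _ _ x≤y y≤z , ≤-trans _ _ _ z≤y y≤x

  -- Whatever lies below `y` is at most some child of `x`, so the recursion is structural in `x`.
  ≤⇒Acc : ∀ x y → y ≤ x → Acc _<_ y
  ≤⇒Acc x y y≤x = acc λ {z} z<y → below x z (<-≤-trans z y x z<y y≤x)
    where
    below : ∀ x z → z < x → Acc _<_ z
    below (node g) z (n , z≤gn) = ≤⇒Acc (g n) z z≤gn

  <-wellFounded : WellFounded _<_
  <-wellFounded x = ≤⇒Acc x x (≤-refl x)

  <-irrefl : ∀ x → ¬ (x < x)
  <-irrefl = All.wfRec <-wellFounded 0ℓ _ λ x ih x<x → ih x<x x<x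

-- Linearity, countable segments and representatives of ranks

module CanonicalTrees (em : ExcludedMiddle 0ℓ) (ext : Extensionality 0ℓ 0ℓ) where

  open Trees

  ≤⊎> : ∀ x y → x ≤ y ⊎ y < x
  ≤⊎> leaf     y = inj₁ tt
  ≤⊎> (node f) y with em {∃[ n ] y ≤ f n}
  ... | yes y<x = inj₂ y<x
  ... | no  y≮x = inj₁ λ n → f<y n (≤⊎> y (f n))
    where
    f<y : ∀ n → y ≤ f n ⊎ f n < y → f n < y
    f<y n (inj₁ y≤fn) = contradiction (n , y≤fn) y≮x
    f<y n (inj₂ fn<y) = fn<y

  -- For `y < x`, a path of child indices from `x` down to a subtree of the same rank as `y`; a
  -- second component 0 ends the path.
  code : Tree → Tree → ℕ
  code leaf     y = 0
  code (node g) y with em {y < node g}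
  ... | no  _       = 0
  ... | yes (n , _) with em {y < g n}
  ...   | yes _ = pair n (suc (code (g n) y))
  ...   | no  _ = pair n 0

  ≮⇒≥ : ∀ x y → ¬ (x < y) → y ≤ x
  ≮⇒≥ x y x≮y with ≤⊎> y x
  ... | inj₁ y≤x = y≤x
  ... | inj₂ x<y = contradiction x<y x≮y

  code-injective : ∀ x {y z} → y < x → z < x → code x y ≡ code x z → y ≤ z
  code-injective (node g) {y} {z} y<x z<x eq with em {y < node g} | em {z < node g}
  ... | no y≮x | _      = contradiction y<x y≮x
  ... | yes _  | no z≮x = contradiction z<x z≮x
  ... | yes (m , y≤gm) | yes (n , z≤gn) with em {y < g m} | em {z < g n}
  ...   | yes y<gm | yes z<gn with refl , eq′ ← pair-injective m _ {n} eq
    = code-injective (g m) y<gm z<gn (ℕ.suc-injective eq′)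
  ...   | yes _    | no  _    with () ← proj₂ (pair-injective m _ {n} eq)
  ...   | no  _    | yes _    with () ← proj₂ (pair-injective m _ {n} eq)
  ...   | no  _    | no  z≮gn with refl , _ ← pair-injective m _ {n} eq
    = ≤-trans _ _ _ y≤gm (≮⇒≥ z (g m) z≮gn)

  class : Tree → Tree → Bool
  class x y = does (em {x ∼ y})

  -- `em` acts as a choice operator: the tree found depends on `P` alone. The default `leaf` never
  -- arises from a class, since `x` belongs to `class x`.
  choose : (Tree → Bool) → Tree
  choose P with em {∃[ y ] P y ≡ true}
  ... | yes (y , _) = y
  ... | no  _       = leaf

  -- Equivalent trees have equal classes only because these are Bool-valued.
  canonical : Tree → Tree
  canonical x = choose (class x)

  canonical-cong : ∀ {x y} → x ∼ y → canonical x ≡ canonical y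
  canonical-cong x∼y = cong choose (ext λ z →
    does-⇔ (mk⇔ (∼-trans (∼-sym x∼y)) (∼-trans x∼y)) em em)

  canonical-∼ : ∀ x → x ∼ canonical x
  canonical-∼ x with em {∃[ y ] class x y ≡ true}
  ... | no none = contradiction (x , dec-true em (≤-refl x , ≤-refl x)) none
  ... | yes (y , x∼y) with yes p ← em {x ∼ y} = p

  W : Set
  W = Σ[ x ∈ Tree ] canonical x ≡ x

  rank : Tree → W
  rank x = canonical x , canonical-cong (∼-sym (canonical-∼ x))

  infix 4 _≺_

  _≺_ : Rel W 0ℓ
  (x , _) ≺ (y , _) = x < y

  ∼⇒≡ : ∀ {v w : W} → proj₁ v ∼ proj₁ w → v ≡ w
  ∼⇒≡ {x , p} {y , q} x∼y with refl ← trans (sym p) (trans (canonical-cong x∼y) q)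
    = cong (x ,_) (uip p q)

  ≺-wellFounded : WellFounded _≺_
  ≺-wellFounded (x , _) = lift (<-wellFounded x)
    where
    lift : ∀ {x p} → Acc _<_ x → Acc _≺_ (x , p)
    lift (acc rs) = acc λ y<x → lift (rs y<x)

  ≺-compare : Trichotomous _≡_ _≺_
  ≺-compare (x , _) (y , _) with ≤⊎> x y | ≤⊎> y x
  ... | inj₂ y<x | _ =
    tri> (λ x<y → <-irrefl x (<-trans x y x x<y y<x)) (λ { refl → <-irrefl x y<x }) y<x
  ... | inj₁ _ | inj₂ x<y =
    tri< x<y (λ { refl → <-irrefl x x<y }) (λ y<x → <-irrefl x (<-trans x y x x<y y<x))
  ... | inj₁ x≤y | inj₁ y≤x =
    tri≈ (λ x<y → <-irrefl x (<-≤-trans x y x x<y y≤x)) (∼⇒≡ (x≤y , y≤x))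
         (λ y<x → <-irrefl y (<-≤-trans y x y y<x x≤y))

  ≺-sup : HasSuprema _≺_
  ≺-sup s = rank t , λ n → <-≤-trans _ t _ (n , ≤-refl _) (proj₁ (canonical-∼ t))
    where t = node (proj₁ ∘ s)

  -- Otherwise `inverse` enumerates `W`, and a strict bound of the enumeration lies below itself.
  W-uncountable : ¬ Countable {W} (λ _ → ⊤)
  W-uncountable (f , f-injective) =
    let h , below = ≺-sup inverse
    in <-irrefl (proj₁ h) (subst (_≺ h) (inverse-left h) (below (f h)))
    where
    inverse : ℕ → W
    inverse n with em {∃[ w ] f w ≡ n}
    ... | yes (w , _) = w
    ... | no  _       = rank leaf
    inverse-left : ∀ w → inverse (f w) ≡ w
    inverse-left w with em {∃[ v ] f v ≡ f w}
    ... | yes (v , eq) = f-injective tt tt eq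
    ... | no none      = contradiction (w , refl) none

  ≺-isω₁ : Isω₁ _≺_
  ≺-isω₁ = record
    { isStrictTotalOrder = record
      { isStrictPartialOrder = record
        { isEquivalence = isEquivalence
        ; irrefl        = λ { {x , _} refl → <-irrefl x }
        ; trans         = λ {x y z} → <-trans (proj₁ x) (proj₁ y) (proj₁ z)
        ; <-resp-≈      = (λ { refl p → p }) , (λ { refl p → p })
        }
      ; compare = ≺-compare
      }
    ; wellFounded       = ≺-wellFounded
    ; segmentsCountable = λ (x , _) → (code x ∘ proj₁) , λ y<x z<x eq →
        ∼⇒≡ (code-injective x y<x z<x eq , code-injective x z<x y<x (sym eq))
    ; uncountable       = W-uncountable
    }

-- Unbounded subsets of ω₁

module Order (em : ExcludedMiddle 0ℓ) {X : Set} {_≺_ : Rel X 0ℓ}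
             (isω₁ : Isω₁ _≺_) (sup : HasSuprema _≺_) where

  open Isω₁ isω₁
  open IsStrictTotalOrder isStrictTotalOrder using (compare; irrefl) renaming (trans to ≺-trans)

  next : ∀ w → ∃[ v ] w ≺ v
  next w = let v , w≺v = sup (λ _ → w) in v , w≺v 0

  ≺-irrefl : ∀ {x} → ¬ (x ≺ x)
  ≺-irrefl = irrefl refl

  Unbounded : Subset X → Set
  Unbounded A = ∀ w → ∃[ x ] (A x × w ≺ x)

  ¬Unbounded⇒bound : ∀ {A} → ¬ Unbounded A → ∃[ w ] (∀ x → A x → ¬ (w ≺ x))
  ¬Unbounded⇒bound ¬unb = decidable-stable em λ none →
    ¬unb λ w → decidable-stable em λ none-above →
      none (w , λ x x∈A w≺x → none-above (x , x∈A , w≺x))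

  ¬Unbounded⇒Countable : ∀ {A} → ¬ Unbounded A → Countable A
  ¬Unbounded⇒Countable ¬unb =
    let w , bound = ¬Unbounded⇒bound ¬unb
        v , w≺v = next w
        f , f-injective = segmentsCountable v
        below : ∀ x → _ → x ≺ v
        below x x∈A = case compare x w of λ where
          (tri< x≺w _ _)  → ≺-trans x≺w w≺v
          (tri≈ _ refl _) → w≺v
          (tri> _ _ w≺x)  → contradiction w≺x (bound x x∈A)
    in f , λ x∈A y∈A → f-injective (below _ x∈A) (below _ y∈A)

  inhabitant : X
  inhabitant = decidable-stable em λ empty →
    uncountable ((λ _ → 0) , λ {x} _ _ _ → contradiction x empty)

  Unbounded-U : Unbounded (λ _ → ⊤)
  Unbounded-U w = let x , w≺x = next w in x , tt , w≺x

  Unbounded-above : ∀ {A} → Unbounded A → ∀ w → Unbounded (λ x → A x × w ≺ x)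
  Unbounded-above {A} unb w v with compare v w
  ... | tri< v≺w _ _  = let x , x∈A , w≺x = unb w in x , (x∈A , w≺x) , ≺-trans v≺w w≺x
  ... | tri≈ _ refl _ = let x , x∈A , w≺x = unb w in x , (x∈A , w≺x) , w≺x
  ... | tri> _ _ w≺v  = let x , x∈A , v≺x = unb v in x , (x∈A , ≺-trans w≺v v≺x) , v≺x

  opaque
    -- Otherwise every `n` has a bound, and a point of `A` above all these bounds is related to no
    -- `n`.
    pigeonhole : ∀ {A} → Unbounded A → (R : X → ℕ → Set) → (∀ x → A x → ∃[ n ] R x n) →
                 ∃[ n ] Unbounded (λ x → A x × R x n)
    pigeonhole {A} unb R total = decidable-stable em λ none →
      let bound n = ¬Unbounded⇒bound (λ unbₙ → none (n , unbₙ))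
          h , bound≺h = sup (λ n → proj₁ (bound n))
          x , x∈A , h≺x = unb h
          n , r = total x x∈A
      in proj₂ (bound n) x (x∈A , r) (≺-trans (bound≺h n) h≺x)

  module _ {A : Subset X} (unb : Unbounded A) where

    climb : ℕ → ∃[ x ] A x
    climb zero    = let x , x∈A , _ = unb inhabitant in x , x∈A
    climb (suc n) = let x , x∈A , _ = unb (proj₁ (climb n)) in x , x∈A

    climb-mono : ∀ {m n} → m ℕ.<′ n → proj₁ (climb m) ≺ proj₁ (climb n)
    climb-mono {m} ℕ.<′-base       = proj₂ (proj₂ (unb (proj₁ (climb m))))
    climb-mono {m} (ℕ.≤′-step {n} m<n) =
      ≺-trans (climb-mono m<n) (proj₂ (proj₂ (unb (proj₁ (climb n)))))

    climb-injective : ∀ {m n} → proj₁ (climb m) ≡ proj₁ (climb n) → m ≡ n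
    climb-injective {m} {n} eq with ℕ.<-cmp m n
    ... | tri< m<n _ _ = contradiction (climb-mono (ℕ.<⇒<′ m<n)) (irrefl eq)
    ... | tri≈ _ m≡n _ = m≡n
    ... | tri> _ _ n<m = contradiction (climb-mono (ℕ.<⇒<′ n<m)) (irrefl (sym eq))

    -- `h` bounds an increasing sequence in `A`. Infinity is expressed as escaping every list, to
    -- match the lists that compactness yields.
    infinite-below : ∃[ h ] (∀ xs → ∃[ x ] (A x × x ≺ h × ¬ (x ∈ₗ xs)))
    infinite-below = h , λ xs → decidable-stable em λ none →
      finite (mk↣ climb-injective) xs λ n → decidable-stable em λ n∉xs →
        none (proj₁ (climb n) , proj₂ (climb n) , climb≺h n , n∉xs)
      where
      h = proj₁ (sup (proj₁ ∘ climb))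
      climb≺h = proj₂ (sup (proj₁ ∘ climb))

  -- Ulam matrix and a colouring with unbounded fibres

  module Ulam where

    index : X → X → ℕ
    index x = proj₁ (segmentsCountable x)

    -- For a fixed n these sets are pairwise disjoint.
    Entry : ℕ → X → Subset X
    Entry n γ x = γ ≺ x × index x γ ≡ n

    -- For fixed `γ` the entries cover everything above `γ`.
    row : ∀ γ → ∃[ n ] Unbounded (Entry n γ)
    row γ =
      let n , unb = pigeonhole (Unbounded-above Unbounded-U γ)
                      (λ x n → index x γ ≡ n) (λ x _ → index x γ , refl)
      in n , λ w → let x , ((_ , γ≺x) , eq) , w≺x = unb w in x , (γ≺x , eq) , w≺x

    column : ∃[ n ] Unbounded (λ γ → ⊤ × Unbounded (Entry n γ))
    column = pigeonhole Unbounded-U (λ γ n → Unbounded (Entry n γ)) (λ γ _ → row γ)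

    module _ (n : ℕ) (γ : ℕ → X) (γ-injective : ∀ {i j} → γ i ≡ γ j → i ≡ j) where

      colour : X → ℕ
      colour x with em {∃[ m ] Entry n (γ m) x}
      ... | yes (m , _) = m
      -- Points in no entry only enlarge fibre 0.
      ... | no  _       = 0

      colour-Entry : ∀ m {x} → Entry n (γ m) x → colour x ≡ m
      colour-Entry m {x} entry@(γ≺x , eq) with em {∃[ m ] Entry n (γ m) x}
      ... | no none = contradiction (m , entry) none
      ... | yes (m′ , γ′≺x , eq′) = γ-injective
        (proj₂ (segmentsCountable x) γ′≺x γ≺x (trans eq′ (sym eq)))

  opaque
    colouring : Σ[ c ∈ (X → ℕ) ] (∀ m → Unbounded (λ x → c x ≡ m))
    colouring =
      let n , unb = Ulam.column
          γs = climb unb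
          γ-injective = climb-injective unb
      in Ulam.colour n (proj₁ ∘ γs) γ-injective , λ m w →
         let x , entry , w≺x = proj₂ (proj₂ (γs m)) w
         in x , Ulam.colour-Entry n (proj₁ ∘ γs) γ-injective m entry , w≺x

-- The space

open import Data.Nat.Base using (_≤_; _<_; _⊔_)

-- Finite unions of compact sets

module _ {X : Set} (𝒯 : Topology X) where

  compact-∅ : ∀ {K} → Empty K → Compact 𝒯 K
  compact-∅ empty I A A-open cover = [] , λ x∈K → contradiction x∈K (empty _)

  compact-Any : ∀ {B : Set} {K : B → Subset X} → (∀ b → Compact 𝒯 (K b)) →
                ∀ bs → Compact 𝒯 (λ x → Any (λ b → K b x) bs)
  compact-Any K-compact []       I A A-open cover = [] , λ ()
  compact-Any K-compact (b ∷ bs) I A A-open cover =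
    let is , is-cover = K-compact b I A A-open (cover ∘ here)
        js , js-cover = compact-Any K-compact bs I A A-open (cover ∘ there)
    in is ++ js , λ where
         (here x∈K)  → ++⁺ˡ (is-cover x∈K)
         (there any) → ++⁺ʳ is (js-cover any)

  compact-< : ∀ {K : ℕ → Subset X} → (∀ j → Compact 𝒯 (K j)) →
              ∀ m → Compact 𝒯 (λ x → ∃[ j ] (j < m × K j x))
  compact-< K-compact zero    I A A-open cover = [] , λ ()
  compact-< K-compact (suc m) I A A-open cover =
    let is , is-cover = K-compact m I A A-open (λ x∈K → cover (m , ℕ.n<1+n m , x∈K))
        js , js-cover = compact-< K-compact m I A A-open
          (λ (j , j<m , x∈K) → cover (j , ℕ.m<n⇒m<1+n j<m , x∈K))
    in is ++ js , λ (j , j<1+m , x∈K) → case ℕ.m<1+n⇒m<n∨m≡n j<1+m of λ where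
         (inj₁ j<m)  → ++⁺ʳ is (js-cover (j , j<m , x∈K))
         (inj₂ refl) → ++⁺ˡ (is-cover x∈K)

  compact-≐ : ∀ {K L} → K ≐ L → Compact 𝒯 K → Compact 𝒯 L
  compact-≐ (K⊆L , L⊆K) K-compact I A A-open cover =
    let is , is-cover = K-compact I A A-open (cover ∘ K⊆L) in is , is-cover ∘ L⊆K

module Construction
  (em : ExcludedMiddle 0ℓ) (ext : Extensionality 0ℓ 0ℓ)
  {X : Set} {_≺_ : Rel X 0ℓ} (isω₁ : Isω₁ _≺_) (sup : HasSuprema _≺_)
  (c : X → ℕ) (c-unbounded : ∀ n → Order.Unbounded em isω₁ sup (λ x → c x ≡ n))
  where

  open Order em isω₁ sup
  open Isω₁ isω₁
  open IsStrictTotalOrder isStrictTotalOrder using (compare; irrefl) renaming (trans to ≺-trans)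

  -- Neighbourhoods by recursion along the order

  Below : X → Set
  Below α = Σ[ β ∈ X ] β ≺ α

  index : X → X → ℕ
  index α = proj₁ (segmentsCountable α)

  module Step (α : X) (M : ∀ β → β ≺ α → ℕ → Subset X) where

    -- A finite union, since `index α` is injective below `α`.
    Covered : ℕ → Subset X
    Covered j δ = ∃[ i ] (i < j × Σ[ β ∈ X ] Σ[ β≺α ∈ β ≺ α ] (index α β ≡ i × M β β≺α 0 δ))

    Piece : Set
    Piece = Below α × ℕ

    ⟦_⟧ : Piece → Subset X
    ⟦ (γ , γ≺α) , l ⟧ = M γ γ≺α l

    Safe : ℕ → Piece → Set
    Safe j p = ∀ δ → ⟦ p ⟧ δ → j ≤ c δ × ¬ Covered j δ

    -- With `suc j`, a point first covered by the neighbourhood of index `j` is active at stage `j`,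
    -- while safe pieces avoid only `Covered j` and can still come near it.
    Active : ℕ → Subset X
    Active j β = c β ≤ j × Covered (suc j) β

    -- (just β , η) asks for a point of M β j above η, and (nothing , η) for any
    -- point above η.
    Target : Set
    Target = Maybe X × X

    Due : ℕ → Target → Set
    Due j (b , η) = Maybe.All (Active j) b × Active j η

    Hits : ℕ → Target → Piece → Set
    Hits j (b , η) ((γ , _) , _) =
      Maybe.All (λ β → Σ[ β≺α ∈ β ≺ α ] M β β≺α j γ) b × η ≺ γ

    HitsAll : ℕ → List Piece → Set
    HitsAll j ps = ∀ t → Due j t → ∃[ p ] (Safe j p × Hits j t p) → Any (Hits j t) ps

    -- The fallback [] is never used: see pieces-hit, whose proof needs the
    -- compactness of the sets M β k and hence already safety.
    pieces : ∀ j → Σ[ ps ∈ List Piece ]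
      (All (Safe j) ps × (Σ[ qs ∈ List Piece ] (All (Safe j) qs × HitsAll j qs) → HitsAll j ps))
    pieces j with em {Σ[ ps ∈ List Piece ] (All (Safe j) ps × HitsAll j ps)}
    ... | yes (ps , safe , hits) = ps , safe , λ _ → hits
    ... | no none                = [] , [] , λ some → contradiction some none

    neighbourhood : ℕ → Subset X
    neighbourhood k δ = δ ≡ α ⊎ ∃[ j ] (k ≤ j × Any (λ p → ⟦ p ⟧ δ) (proj₁ (pieces j)))

  build : ∀ α → Acc _≺_ α → ℕ → Subset X
  build α (acc rs) = Step.neighbourhood α (λ β β≺α → build β (rs β≺α))

  -- `build` hands down the proofs `rs β≺α` instead of `wellFounded β`; `N-unfold` identifies the
  -- two.
  Acc-irrelevant : ∀ {α} (p q : Acc _≺_ α) → p ≡ q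
  Acc-irrelevant (acc rs) (acc rs′) = cong acc (implicit-extensionality ext λ {β} →
    ext λ β≺α → Acc-irrelevant (rs β≺α) (rs′ β≺α))

  opaque

    N : X → ℕ → Subset X
    N α = build α (wellFounded α)

    N-unfold : ∀ α → N α ≡ Step.neighbourhood α (λ β _ → N β)
    N-unfold α = cong (build α) (Acc-irrelevant (wellFounded α) (acc λ {β} _ → wellFounded β))

  module At (α : X) = Step α (λ β _ → N β)

  N-split : ∀ {α k δ} → N α k δ → At.neighbourhood α k δ
  N-split {α} {k} {δ} = subst (λ P → P k δ) (N-unfold α)

  N-join : ∀ {α k δ} → At.neighbourhood α k δ → N α k δ
  N-join {α} {k} {δ} = subst (λ P → P k δ) (sym (N-unfold α))

  pieces : ∀ α j → List (Below α × ℕ)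
  pieces α j = proj₁ (At.pieces α j)

  pieces-safe : ∀ α j → All (At.Safe α j) (pieces α j)
  pieces-safe α j = proj₁ (proj₂ (At.pieces α j))

  centre : ∀ {α k} → N α k α
  centre = N-join (inj₁ refl)

  N-antitone : ∀ {α k l} → k ≤ l → N α l ⊆ N α k
  N-antitone k≤l δ∈N = N-join (case N-split δ∈N of λ where
    (inj₁ eq)            → inj₁ eq
    (inj₂ (j , l≤j , p)) → inj₂ (j , ℕ.≤-trans k≤l l≤j , p))

  data InPiece (α : X) (k : ℕ) (δ : X) : Set where
    inPiece : ∀ j γ l → k ≤ j → γ ≺ α → N γ l δ → N γ l ⊆ N α k →
              (∀ ε → N γ l ε → j ≤ c ε × ¬ At.Covered α j ε) → InPiece α k δ

  N-cases : ∀ {α k δ} → N α k δ → δ ≡ α ⊎ InPiece α k δ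
  N-cases {α} {k} {δ} δ∈N = case N-split δ∈N of λ where
    (inj₁ eq)              → inj₁ eq
    (inj₂ (j , k≤j , any)) →
      let ((γ , γ≺α) , l) , p∈ps , δ∈p = find any
      in inj₂ (inPiece j γ l k≤j γ≺α δ∈p
           (λ ε∈p → N-join (inj₂ (j , k≤j , lose p∈ps ε∈p)))
           (All.lookup (pieces-safe α j) p∈ps))

  N-below : ∀ {α k δ} → N α k δ → δ ≡ α ⊎ δ ≺ α
  N-below {α} {k} {δ} = All.wfRec wellFounded 0ℓ
    (λ α → ∀ k → N α k δ → δ ≡ α ⊎ δ ≺ α) step α k
    where
    step : ∀ α → (∀ {γ} → γ ≺ α → ∀ l → N γ l δ → δ ≡ γ ⊎ δ ≺ γ) →
           ∀ k → N α k δ → δ ≡ α ⊎ δ ≺ α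
    step α ih k δ∈N with N-cases δ∈N
    ... | inj₁ eq = inj₁ eq
    ... | inj₂ (inPiece j γ l _ γ≺α δ∈p _ _) with ih γ≺α l δ∈p
    ...   | inj₁ refl = inj₂ γ≺α
    ...   | inj₂ δ≺γ  = inj₂ (≺-trans δ≺γ γ≺α)

  -- The topology: local compactness, scatteredness, separation

  IsOpenᴺ : Subset X → Set
  IsOpenᴺ A = ∀ δ → A δ → ∃[ k ] N δ k ⊆ A

  N-open : ∀ α k → IsOpenᴺ (N α k)
  N-open α k δ = All.wfRec wellFounded 0ℓ
    (λ α → ∀ k → N α k δ → ∃[ l ] N δ l ⊆ N α k) step α k
    where
    step : ∀ α → (∀ {γ} → γ ≺ α → ∀ k → N γ k δ → ∃[ l ] N δ l ⊆ N γ k) →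
           ∀ k → N α k δ → ∃[ l ] N δ l ⊆ N α k
    step α ih k δ∈N with N-cases δ∈N
    ... | inj₁ refl = k , id
    ... | inj₂ (inPiece j γ l _ γ≺α δ∈p p⊆N _) =
      let m , N⊆p = ih γ≺α l δ∈p in m , λ ε∈N → p⊆N (N⊆p ε∈N)

  𝒯 : Topology X
  𝒯 = record
    { IsOpen    = IsOpenᴺ
    ; open-resp = λ (A⊆B , B⊆A) A-open δ δ∈B →
        let k , N⊆A = A-open δ (B⊆A δ∈B) in k , λ ε∈N → A⊆B (N⊆A ε∈N)
    ; open-∅    = λ _ ()
    ; open-U    = λ _ _ → 0 , λ _ → tt
    ; open-∩    = λ A-open B-open δ (δ∈A , δ∈B) →
        let k , N⊆A = A-open δ δ∈A
            l , N⊆B = B-open δ δ∈B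
        in k ⊔ l , λ ε∈N → N⊆A (N-antitone (ℕ.m≤m⊔n k l) ε∈N) , N⊆B (N-antitone (ℕ.m≤n⊔m k l) ε∈N)
    ; open-⋃    = λ I A A-open δ (i , δ∈A) →
        let k , N⊆A = A-open i δ δ∈A in k , λ ε∈N → i , N⊆A ε∈N
    }

  firstCountable : FirstCountable 𝒯
  firstCountable x = N x , (λ n → N-open x n , centre) , λ A A-open → A-open x

  -- A member of the cover containing `α` contains some `N α m`. Only the layers `j < m` remain, and
  -- each is a finite union of sets compact by induction.
  N-compact : ∀ α k → Compact 𝒯 (N α k)
  N-compact = All.wfRec wellFounded _ (λ α → ∀ k → Compact 𝒯 (N α k)) step
    where
    step : ∀ α → (∀ {γ} → γ ≺ α → ∀ l → Compact 𝒯 (N γ l)) → ∀ k → Compact 𝒯 (N α k)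
    step α ih k I A A-open cover =
      let i , α∈A = cover centre
          m , N⊆A = A-open i α α∈A
          is , is-cover = compact-< 𝒯 layer-compact m I A A-open λ (j , _ , k≤j , any) →
            cover (N-join (inj₂ (j , k≤j , any)))
      in i ∷ is , λ δ∈N → case N-split δ∈N of λ where
           (inj₁ refl)          → here α∈A
           (inj₂ (j , k≤j , any)) → case ℕ.<-≤-connex j m of λ where
             (inj₁ j<m) → there (is-cover (j , j<m , k≤j , any))
             (inj₂ m≤j) → here (N⊆A (N-join (inj₂ (j , m≤j , any))))
      where
      layer-compact : ∀ j →
        Compact 𝒯 (λ δ → k ≤ j × Any (λ p → At.⟦_⟧ α p δ) (pieces α j))
      layer-compact j with k ℕ.≤? j
      ... | yes k≤j = compact-≐ 𝒯 ((k≤j ,_) , proj₂)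
                        (compact-Any 𝒯 (λ ((γ , γ≺α) , l) → ih γ≺α l) (pieces α j))
      ... | no  k≰j = compact-∅ 𝒯 λ δ (k≤j , _) → k≰j k≤j

  locallyCompact : LocallyCompact 𝒯
  locallyCompact x = N x 0 , N x 0 , N-compact x 0 , N-open x 0 , centre , id

  -- `N x 0` has no point above `x`, so it isolates the least element of `A`.
  scattered : Scattered 𝒯
  scattered A (a , a∈A) = All.wfRec wellFounded _
    (λ x → A x → ∃[ x ] (x ∈ A × IsolatedIn 𝒯 A x)) step a a∈A
    where
    step : ∀ x → (∀ {y} → y ≺ x → A y → ∃[ x ] (x ∈ A × IsolatedIn 𝒯 A x)) →
           A x → ∃[ x ] (x ∈ A × IsolatedIn 𝒯 A x)
    step x ih x∈A with em {∃[ y ] (y ≺ x × A y)}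
    ... | yes (y , y≺x , y∈A) = ih y≺x y∈A
    ... | no minimal = x , x∈A , N x 0 , N-open x 0 ,
      (λ (y∈A , y∈N) → case N-below y∈N of λ where
        (inj₁ y≡x) → sym y≡x
        (inj₂ y≺x) → contradiction (_ , y≺x , y∈A) minimal) ,
      λ { refl → x∈A , centre }

  -- Stages after `index α β` avoid `N β 0`, and `α` itself is too large to lie in it.
  separate-≺ : ∀ {α β} → β ≺ α → Empty (N α (suc (index α β)) ∩ N β 0)
  separate-≺ {α} {β} β≺α δ (δ∈Nα , δ∈Nβ) with N-cases δ∈Nα
  ... | inj₂ (inPiece j γ l i<j γ≺α δ∈p _ safe) =
    proj₂ (safe δ δ∈p) (index α β , i<j , β , β≺α , refl , δ∈Nβ)
  ... | inj₁ refl with N-below δ∈Nβ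
  ...   | inj₁ refl = ≺-irrefl β≺α
  ...   | inj₂ α≺β  = ≺-irrefl (≺-trans α≺β β≺α)

  separate : ∀ {x y} → x ≢ y → ∃[ k ] ∃[ l ] Empty (N x k ∩ N y l)
  separate {x} {y} x≢y with compare x y
  ... | tri< x≺y _ _ = 0 , suc (index y x) , λ δ (δ∈Nx , δ∈Ny) → separate-≺ x≺y δ (δ∈Ny , δ∈Nx)
  ... | tri≈ _ x≡y _ = contradiction x≡y x≢y
  ... | tri> _ _ y≺x = suc (index x y) , 0 , separate-≺ y≺x

  hausdorff : Hausdorff 𝒯
  hausdorff x y x≢y =
    let k , l , disjoint = separate x≢y
    in N x k , N y l , N-open x k , N-open y l , centre , centre , disjoint

  -- Finiteness and closedness properties of compact sets

  opaque
    -- The neighbourhoods N δ (suc j) meet {c ≤ j} at most in their centre.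
    compact⇒finite : ∀ {K} → Compact 𝒯 K → ∀ j →
                     Σ[ xs ∈ List X ] (∀ {x} → K x → c x ≤ j → x ∈ₗ xs)
    compact⇒finite {K} K-compact j =
      let xs , xs-cover = K-compact X (λ δ → N δ (suc j)) (λ δ → N-open δ (suc j)) (λ {δ} _ → δ , centre)
      in xs , λ x∈K cx≤j → Any.map (only-centre cx≤j) (xs-cover x∈K)
      where
      only-centre : ∀ {x δ} → c x ≤ j → N δ (suc j) x → x ≡ δ
      only-centre cx≤j x∈N with N-cases x∈N
      ... | inj₁ eq = eq
      ... | inj₂ (inPiece i γ l j<i _ x∈p _ safe) =
        contradiction (ℕ.≤-trans j<i (proj₁ (safe _ x∈p))) (ℕ.≤⇒≯ cx≤j)

  opaque
    -- Cover `K` by sets `N δ k`, each disjoint from some `N γ l`; the maximum of the finitely many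
    -- `l` works.
    compact⇒closed : ∀ {K} → Compact 𝒯 K → ∀ {γ} → ¬ K γ → ∃[ l ] Empty (N γ l ∩ K)
    compact⇒closed {K} K-compact {γ} γ∉K =
      let is , is-cover = K-compact I (λ (δ , k , _) → N δ k) (λ (δ , k , _) → N-open δ k)
            (λ {δ} δ∈K → (δ , separate λ { refl → γ∉K δ∈K }) , centre)
      in radius is , λ δ (δ∈N , δ∈K) → disjoint is δ∈N (is-cover δ∈K)
      where
      I : Set
      I = ∃[ δ ] ∃[ k ] ∃[ l ] Empty (N δ k ∩ N γ l)

      radius : List I → ℕ
      radius []                    = 0
      radius ((_ , _ , l , _) ∷ is) = l ⊔ radius is

      disjoint : ∀ is {δ} → N γ (radius is) δ → ¬ Any (λ (ε , k , _) → N ε k δ) is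
      disjoint ((_ , _ , l , empty) ∷ is) δ∈N (here δ∈M) =
        empty _ (δ∈M , N-antitone (ℕ.m≤m⊔n l (radius is)) δ∈N)
      disjoint ((_ , _ , l , _) ∷ is) δ∈N (there any) =
        disjoint is (N-antitone (ℕ.m≤n⊔m l (radius is)) δ∈N) any

  -- Each index contributes at most one set `N β 0`.
  Covered-compact : ∀ α j → Compact 𝒯 (At.Covered α j)
  Covered-compact α = compact-< 𝒯 level
    where
    level : ∀ i → Compact 𝒯 (λ δ → Σ[ β ∈ X ] Σ[ _ ∈ β ≺ α ] (index α β ≡ i × N β 0 δ))
    level i with em {Σ[ β ∈ X ] (β ≺ α × index α β ≡ i)}
    ... | no none = compact-∅ 𝒯 λ δ (β , β≺α , eq , _) → none (β , β≺α , eq)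
    ... | yes (β , β≺α , eq) = compact-≐ 𝒯
      ((λ δ∈N → β , β≺α , eq , δ∈N) ,
       λ (β′ , β′≺α , eq′ , δ∈N) → subst (λ β → N β 0 _)
         (proj₂ (segmentsCountable α) β′≺α β≺α (trans eq′ (sym eq))) δ∈N)
      (N-compact β 0)

  -- Meeting the targets of a stage

  hitting-list : ∀ {P T : Set} (Q : P → Set) (R : T → P → Set) (ts : List T) →
    Σ[ ps ∈ List P ] (All Q ps × (∀ t → t ∈ₗ ts → ∃[ p ] (Q p × R t p) → Any (R t) ps))
  hitting-list Q R []       = [] , [] , λ _ ()
  hitting-list Q R (t ∷ ts) with hitting-list Q R ts | em {∃[ p ] (Q p × R t p)}
  ... | ps , safe , hits | yes (p , q , r) = p ∷ ps , q ∷ safe , λ where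
    _ (here refl) _    → here r
    t (there t∈ts) some → there (hits t t∈ts some)
  ... | ps , safe , hits | no none = ps , safe , λ where
    _ (here refl) some  → contradiction some none
    t (there t∈ts) some → hits t t∈ts some

  -- Active points have colour at most `j` and lie in a compact set, so only finitely many targets
  -- are due and a suitable list exists.
  pieces-hit : ∀ α j → At.HitsAll α j (pieces α j)
  pieces-hit α j =
    let active , active-complete = compact⇒finite (Covered-compact α (suc j)) j
        targets = cartesianProduct (nothing ∷ map just active) active
        complete : ∀ t → At.Due α j t → t ∈ₗ targets
        complete = λ where
          (nothing , η) (_ , cη≤j , η∈C) →
            ∈-cartesianProduct⁺ {xs = nothing ∷ map just active} (here refl) (active-complete η∈C cη≤j)
          (just β , η) (Maybe.just (cβ≤j , β∈C) , cη≤j , η∈C) →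
            ∈-cartesianProduct⁺ {xs = nothing ∷ map just active}
              (there (∈-map⁺ just (active-complete β∈C cβ≤j))) (active-complete η∈C cη≤j)
        ps , safe , hits = hitting-list (At.Safe α j) (At.Hits α j) targets
    in proj₂ (proj₂ (At.pieces α j)) (ps , safe , λ t due → hits t (complete t due))

  -- From level `j` on, the points of `N γ` other than `γ` have colour at least `j`; some further
  -- level misses the closed set `Covered α j`.
  safe-piece : ∀ {α j γ} (γ≺α : γ ≺ α) → j ≤ c γ → ¬ At.Covered α j γ →
               ∃[ l ] At.Safe α j ((γ , γ≺α) , l)
  safe-piece {α} {j} {γ} γ≺α j≤cγ γ∉C =
    let l , disjoint = compact⇒closed (Covered-compact α j) γ∉C
    in j ⊔ l , λ δ δ∈N →
         large δ∈N , λ δ∈C → disjoint δ (N-antitone (ℕ.m≤n⊔m j l) δ∈N , δ∈C)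
    where
    large : ∀ {l δ} → N γ (j ⊔ l) δ → j ≤ c δ
    large {l} δ∈N with N-cases δ∈N
    ... | inj₁ refl = j≤cγ
    ... | inj₂ (inPiece i _ _ j⊔l≤i _ δ∈p _ safe) =
      ℕ.≤-trans (ℕ.≤-trans (ℕ.m≤m⊔n j l) j⊔l≤i) (proj₁ (safe _ δ∈p))

  Covered-monotone : ∀ {α i j} → i ≤ j → At.Covered α i ⊆ At.Covered α j
  Covered-monotone i≤j (k , k<i , rest) = k , ℕ.<-≤-trans k<i i≤j , rest

  ≺⇒Covered : ∀ {α β} → β ≺ α → At.Covered α (suc (index α β)) β
  ≺⇒Covered {α} {β} β≺α = index α β , ℕ.n<1+n _ , β , β≺α , refl , centre

  activation : X → X → ℕ
  activation α η = c η ⊔ index α η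

  active : ∀ {α η j} → η ≺ α → activation α η ≤ j → At.Active α j η
  active {α} {η} η≺α act≤j =
    ℕ.m⊔n≤o⇒m≤o (c η) (index α η) act≤j ,
    Covered-monotone (ℕ.s≤s (ℕ.m⊔n≤o⇒n≤o (c η) (index α η) act≤j)) (≺⇒Covered η≺α)

  opaque
    -- The given `γ` only certifies that the target can be met. The point returned is the centre of
    -- a piece actually chosen at stage `j`.
    hit : ∀ {α j} b η → At.Due α j (b , η) → ∀ γ → γ ≺ α → j ≤ c γ → ¬ At.Covered α j γ →
          Maybe.All (λ β → Σ[ _ ∈ β ≺ α ] N β j γ) b → η ≺ γ →
          ∃[ γ ] (Maybe.All (λ β → Σ[ _ ∈ β ≺ α ] N β j γ) b × η ≺ γ ×
                  γ ≺ α × j ≤ c γ × (∀ {k} → k ≤ j → N α k γ))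
    hit {α} {j} b η due γ γ≺α j≤cγ γ∉C near η≺γ =
      let l , safe = safe-piece γ≺α j≤cγ γ∉C
          ((γ′ , γ′≺α) , _) , p∈ps , near′ , η≺γ′ =
            find (pieces-hit α j (b , η) due (((γ , γ≺α) , l) , safe , near , η≺γ))
      in γ′ , near′ , η≺γ′ , γ′≺α , proj₁ (All.lookup (pieces-safe α j) p∈ps γ′ centre) ,
         λ k≤j → N-join (inj₂ (j , k≤j , lose p∈ps centre))

  -- Points above `η` in every neighbourhood

  Rich : X → X → Set
  Rich η β = ∀ n xs → ∃[ x ] (c x ≡ n × η ≺ x × x ≺ β × ¬ (x ∈ₗ xs))

  opaque
    eventually-rich : ∀ η → ∃[ h ] (∀ {β} → h ≺ β → η ≺ β × Rich η β)
    eventually-rich η =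
      let below n = infinite-below (Unbounded-above (c-unbounded n) η)
          h , below≺h = sup (proj₁ ∘ below)
          rich : ∀ {β} → h ≺ β → Rich η β
          rich h≺β n xs =
            let x , (cx≡n , η≺x) , x≺hₙ , x∉xs = proj₂ (below n) xs
            in x , cx≡n , η≺x , ≺-trans x≺hₙ (≺-trans (below≺h n) h≺β) , x∉xs
      in h , λ h≺β → let x , _ , η≺x , x≺β , _ = rich h≺β 0 [] in ≺-trans η≺x x≺β , rich h≺β

  opaque
    -- Only finitely many points of colour at most `j` are covered at stage `j`, so richness in
    -- colour `j` leaves a candidate for the target `(nothing , η)`.
    rich-neighbourhood : ∀ {η β} → η ≺ β → Rich η β →
      ∀ m → ∃[ γ ] (N β m γ × η ≺ γ × m ≤ c γ × γ ≺ β)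
    rich-neighbourhood {η} {β} η≺β rich m =
      let j = m ⊔ activation β η
          xs , xs-complete = compact⇒finite (Covered-compact β j) j
          x , cx≡j , η≺x , x≺β , x∉xs = rich j xs
          γ , _ , η≺γ , γ≺β , j≤cγ , γ∈N = hit nothing η
            (Maybe.nothing , active η≺β (ℕ.m≤n⊔m m _)) x x≺β (ℕ.≤-reflexive (sym cx≡j))
            (λ x∈C → x∉xs (xs-complete x∈C (ℕ.≤-reflexive cx≡j))) Maybe.nothing η≺x
      in γ , γ∈N (ℕ.m≤m⊔n m _) , η≺γ , ℕ.≤-trans (ℕ.m≤m⊔n m _) j≤cγ , γ≺β

  -- Common points of open unbounded sets

  crossing : ∀ {P : ℕ → Set} d j → ¬ P j → P (d ℕ.+ j) → ∃[ i ] (j ≤ i × ¬ P i × P (suc i))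
  crossing zero    j ¬Pj Pj = contradiction Pj ¬Pj
  crossing {P} (suc d) j ¬Pj Pd+j with em {P (suc j)}
  ... | yes P1+j = j , ℕ.≤-refl , ¬Pj , P1+j
  ... | no ¬P1+j =
    let i , j<i , rest = crossing {P} d (suc j) ¬P1+j (subst P (sym (ℕ.+-suc d j)) Pd+j)
    in i , ℕ.<⇒≤ j<i , rest

  opaque
    -- At the stage `j` where `β` is about to become covered, it is active but still outside the
    -- closed set `Covered α j`. Points near `β` are therefore admissible, and the target
    -- `(just β , η)` gets met.
    common-point : ∀ {α β η} j₀ → β ≺ α → η ≺ β → Rich η β → c β ≤ j₀ → activation α η ≤ j₀ →
                   ¬ At.Covered α j₀ β → ∃[ γ ] (N α j₀ γ × N β j₀ γ × η ≺ γ)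
    common-point {α} {β} {η} j₀ β≺α η≺β rich cβ≤j₀ act≤j₀ β∉C₀
      with j , j₀≤j , β∉C , β∈C ← crossing {λ j → At.Covered α j β} (suc (index α β)) j₀ β∉C₀
             (Covered-monotone (ℕ.m≤m+n (suc (index α β)) j₀) (≺⇒Covered β≺α))
      with m , disjoint ← compact⇒closed (Covered-compact α j) β∉C
      -- Level `j` gives colour at least `j` and membership in `N β j`; level `m` avoids
      -- `Covered α j`.
      with γ , γ∈N , η≺γ , j⊔m≤cγ , γ≺β ← rich-neighbourhood η≺β rich (j ⊔ m)
      with γ′ , Maybe.just (_ , γ′∈Nβ) , η≺γ′ , _ , _ , γ′∈Nα ← hit (just β) η
             (Maybe.just (ℕ.≤-trans cβ≤j₀ j₀≤j , β∈C) ,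
              active (≺-trans η≺β β≺α) (ℕ.≤-trans act≤j₀ j₀≤j))
             γ (≺-trans γ≺β β≺α) (ℕ.m⊔n≤o⇒m≤o j m j⊔m≤cγ)
             (λ γ∈C → disjoint γ (N-antitone (ℕ.m≤n⊔m j m) γ∈N , γ∈C))
             (Maybe.just (β≺α , N-antitone (ℕ.m≤m⊔n j m) γ∈N)) η≺γ
      = γ′ , γ′∈Nα j₀≤j , N-antitone j₀≤j γ′∈Nβ , η≺γ′

  -- Unboundedness of the intersection, beyond mere nonemptiness, is what allows iteration over
  -- finite families.
  ∩-unbounded : ∀ {A B} → IsOpenᴺ A → IsOpenᴺ B → Unbounded A → Unbounded B → Unbounded (A ∩ B)
  ∩-unbounded {A} {B} A-open B-open A-unb B-unb η
    with k , A-unb′ ← pigeonhole A-unb (λ α k → N α k ⊆ A) A-open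
    with l , B-unb′ ← pigeonhole B-unb (λ β l → N β l ⊆ B) B-open
    with n , B-unb″ ← pigeonhole B-unb′ (λ β n → c β ≡ n) (λ β _ → c β , refl)
    with h , h-rich ← eventually-rich η
    -- Fixing `h′` before `α` leaves infinitely many candidates `β` below `α`.
    with h′ , infinite ← infinite-below (Unbounded-above B-unb″ h)
    with α , (α∈A , N⊆A) , h′≺α ← A-unb′ h′
    -- The stage dominates `k` and `l` for the inclusions in `A` and `B`, `n` for the colour of `β`,
    -- and the activation of `η`. Finitely many points of colour at most `n` are covered by then, so
    -- some `β` is not.
    with xs , xs-complete ← compact⇒finite
           (Covered-compact α ((k ⊔ l) ⊔ (n ⊔ activation α η))) n
    with β , (((β∈B , N⊆B) , refl) , h≺β) , β≺h′ , β∉xs ← infinite xs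
    with η≺β , rich ← h-rich h≺β
    with γ , γ∈Nα , γ∈Nβ , η≺γ ← common-point ((k ⊔ l) ⊔ (n ⊔ activation α η))
           (≺-trans β≺h′ h′≺α) η≺β rich
           (ℕ.≤-trans (ℕ.m≤m⊔n n _) (ℕ.m≤n⊔m (k ⊔ l) _))
           (ℕ.≤-trans (ℕ.m≤n⊔m n _) (ℕ.m≤n⊔m (k ⊔ l) _))
           (λ β∈C → β∉xs (xs-complete β∈C ℕ.≤-refl))
    = γ , (N⊆A (N-antitone (ℕ.≤-trans (ℕ.m≤m⊔n k l) (ℕ.m≤m⊔n (k ⊔ l) _)) γ∈Nα) ,
           N⊆B (N-antitone (ℕ.≤-trans (ℕ.m≤n⊔m k l) (ℕ.m≤m⊔n (k ⊔ l) _)) γ∈Nβ)) , η≺γ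

  ⋂-open-unbounded : ∀ n (A : Fin n → Subset X) → (∀ i → IsOpenᴺ (A i)) → (∀ i → Unbounded (A i)) →
                     IsOpenᴺ (⋂ (Fin n) A) × Unbounded (⋂ (Fin n) A)
  ⋂-open-unbounded zero    A A-open A-unb =
    (λ _ _ → 0 , λ _ ()) , λ w → let x , w≺x = next w in x , (λ ()) , w≺x
  ⋂-open-unbounded (suc n) A A-open A-unb =
    let tail-open , tail-unb = ⋂-open-unbounded n (A ∘ suc) (A-open ∘ suc) (A-unb ∘ suc)
        cons : A zero ∩ ⋂ (Fin n) (A ∘ suc) ⊆ ⋂ (Fin (suc n)) A
        cons = λ { (x∈A₀ , x∈As) zero → x∈A₀ ; (x∈A₀ , x∈As) (suc i) → x∈As i }
        uncons : ⋂ (Fin (suc n)) A ⊆ A zero ∩ ⋂ (Fin n) (A ∘ suc)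
        uncons = λ x∈A → x∈A zero , x∈A ∘ suc
    in open-resp (cons , uncons) (open-∩ (A-open zero) tail-open) ,
       λ w → let x , x∈A , w≺x = ∩-unbounded (A-open zero) tail-open (A-unb zero) tail-unb w
             in x , cons x∈A , w≺x
    where open Topology 𝒯

  propertyP<ω : PropertyP<ω 𝒯
  propertyP<ω n _ = hausdorff , λ A A-open empty → decidable-stable em λ none →
    let _ , unb = ⋂-open-unbounded n A A-open λ i → decidable-stable em λ bounded →
          none (i , ¬Unbounded⇒Countable bounded)
        x , x∈A , _ = unb inhabitant
    in empty x x∈A

proposition2p2 : ExcludedMiddle 0ℓ → Extensionality 0ℓ 0ℓ →
    Σ[ X ∈ Set ] Σ[ 𝒯 ∈ Topology X ]
    (FirstCountable 𝒯 × LocallyCompact 𝒯 × Scattered 𝒯 ×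
    HasCardinalityω₁ X × PropertyP<ω 𝒯)
proposition2p2 em ext =
  W , 𝒯 , firstCountable , locallyCompact , scattered , (W , _≺_ , ≺-isω₁ , ⤖-id W) , propertyP<ω
  where
  open CanonicalTrees em ext
  c = proj₁ (Order.colouring em ≺-isω₁ ≺-sup)
  c-unbounded = proj₂ (Order.colouring em ≺-isω₁ ≺-sup)
  open Construction em ext ≺-isω₁ ≺-sup c c-unbounded
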